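{- Let $\mathbf{f}$ be the Fibonacci word and let $\mathbf{cubes_f}$ be the infinite binary word whose $n$-th term ($n\ge 0$) is $1$ if a cube ends at position $n$ of $\mathbf{f}$ and $0$ otherwise. Then $\mathbf{cubes_f}$ contains arbitrarily long runs of $1$'s. More precisely: if $i\ge 0$ is such that \[ (i)_F \in (10)^+\,0\,(0+10)\,(00)^*\,0\,w, \qquad \text{where } w \in 0(10)^*(\epsilon+1), \] then $\mathbf{cubes_f}$ contains a run of $1$'s beginning at position $i$ of length \begin{itemize} \item $F_{2n+2}-1$, if $|w|=2n$ for some $n\ge 0$; \item $F_{2n+3}-1$, if $|w|=2n+1$ for some $n\ge 0$. \end{itemize}
   Context: The Fibonacci word is $\mathbf{f}=010010100100101001010010\cdots$, the fixed point of the morphism $0\mapsto 01$, $1\mapsto 0$; its letters are indexed starting from position $0$, and $\mathbf{f}[a..b]$ denotes the factor occupying positions $a$ through $b$. A cube is a word of the form $xxx$ with $x$ nonempty. A cube ends at position $j$ of $\mathbf{f}$ if there exist $i\ge 0$ and $m\ge 1$ with $j=i+3m-1$ such that $\mathbf{f}[i..j]=xxx$ for some word $x$ of length $m$. Fibonacci numbers: $F_0=0$, $F_1=1$, $F_{k+2}=F_{k+1}+F_k$. For $n\ge 0$, $(n)_F$ is the canonical Fibonacci (Zeckendorf) representation of $n$: the unique binary word $d_{k}\cdots d_2$ (most significant digit first), with no leading $0$ and no two consecutive $1$'s, such that $n=\sum_j d_jF_j$ (so the last digit has weight $F_2=1$, the next $F_3=2$, etc.); $(0)_F$ is the empty word.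 In the regular expressions, $+$ between words denotes union, $^*$ Kleene star, $^+$ one or more repetitions, $\epsilon$ the empty word, and $|w|$ the length of $w$. A run of $1$'s of length $\ell\ge1$ beginning at position $i$ in a binary word $\mathbf{u}=u_0u_1\cdots$ means $u_i=\cdots=u_{i+\ell-1}=1$, $u_{i+\ell}=0$, and either $i=0$ or $u_{i-1}=0$ (i.e., a maximal block of $1$'s). -}

module Defs where

open import Data.Nat using (ℕ; zero; suc; _+_; _*_; _∸_; _≤_; _<_)
open import Data.Bool using (Bool; true; false)
open import Data.List using (List; []; _∷_; _++_; concatMap; reverse; length)
open import Data.Product using (Σ; ∃; ∃-syntax; _×_; _,_)
open import Data.Sum using (_⊎_)
open import Relation.Binary.PropositionalEquality using (_≡_)
open import Relation.Nullary using (¬_)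
open import Data.Unit using (⊤)
open import Data.Empty using (⊥)

F : ℕ → ℕ
F zero = 0
F (suc zero) = 1
F (suc (suc k)) = F (suc k) + F k

-- Letters: false = 0, true = 1.
-- The Fibonacci morphism 0 ↦ 01, 1 ↦ 0
φ : List Bool → List Bool
φ = concatMap (λ { false → false ∷ true ∷ [] ; true → false ∷ [] })

φ^ : ℕ → List Bool → List Bool
φ^ zero w = w
φ^ (suc n) w = φ (φ^ n w)

-- lookup with a default value (never used below, since |φ^(n+1)(0)| ≥ n+1)
at : List Bool → ℕ → Bool
at [] _ = false
at (x ∷ xs) zero = x
at (x ∷ xs) (suc n) = at xs n

-- The Fibonacci word f (fixed point of φ): f[n] is the n-th letter of φ^(n+1)(0),
-- every φ^k(0) being a prefix of the fixed point.
fibWord : ℕ → Bool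
fibWord n = at (φ^ (suc n) (false ∷ [])) n

CubeEndsAt : ℕ → Set
CubeEndsAt j = Σ ℕ λ i → Σ ℕ λ m → (1 ≤ m) × (j + 1 ≡ i + 3 * m) ×
  (∀ k → k < m → (fibWord (i + k) ≡ fibWord (i + m + k)) × (fibWord (i + k) ≡ fibWord (i + 2 * m + k)))

-- cubes_f[n] = 1  iff  CubeEndsAt n.
-- A (maximal) run of 1's of length ℓ ≥ 1 beginning at position i in cubes_f.
RunOfOnes : ℕ → ℕ → Set
RunOfOnes i ℓ = (1 ≤ ℓ) × (∀ k → k < ℓ → CubeEndsAt (i + k)) × ¬ CubeEndsAt (i + ℓ) ×
  ((i ≡ 0) ⊎ (Σ ℕ λ p → (i ≡ suc p) × ¬ CubeEndsAt p))

valLSD : List Bool → ℕ → ℕ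
valLSD [] k = 0
valLSD (false ∷ ds) k = valLSD ds (suc k)
valLSD (true ∷ ds) k = F k + valLSD ds (suc k)

val : List Bool → ℕ
val ds = valLSD (reverse ds) 2

NoLeadingZero : List Bool → Set
NoLeadingZero [] = ⊤
NoLeadingZero (b ∷ _) = b ≡ true

NoConsecutiveOnes : List Bool → Set
NoConsecutiveOnes [] = ⊤
NoConsecutiveOnes (_ ∷ []) = ⊤
NoConsecutiveOnes (true ∷ true ∷ _) = ⊥
NoConsecutiveOnes (true ∷ false ∷ ds) = NoConsecutiveOnes (false ∷ ds)
NoConsecutiveOnes (false ∷ d ∷ ds) = NoConsecutiveOnes (d ∷ ds)

IsZeckRep : List Bool → ℕ → Set
IsZeckRep ds n = NoLeadingZero ds × NoConsecutiveOnes ds × (val ds ≡ n)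

rep : ℕ → List Bool → List Bool
rep zero u = []
rep (suc k) u = u ++ rep k u

t f : Bool
t = true
f = false

InPrefixLang : List Bool → Set
InPrefixLang u = Σ ℕ λ a → Σ ℕ λ c → Σ (List Bool) λ b →
  (1 ≤ a) × ((b ≡ f ∷ []) ⊎ (b ≡ t ∷ f ∷ [])) ×
  (u ≡ rep a (t ∷ f ∷ []) ++ (f ∷ []) ++ b ++ rep c (f ∷ f ∷ []) ++ (f ∷ []))

InWLang : List Bool → Set
InWLang w = Σ ℕ λ d → Σ (List Bool) λ e →
  ((e ≡ []) ⊎ (e ≡ t ∷ [])) × (w ≡ (f ∷ []) ++ rep d (t ∷ f ∷ []) ++ e)

{-# OPTIONS --safe #-}

-- Let P(n) = |φ(f[0..n))|, the starting position of the n-th block of f = φ(f); on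
-- Zeckendorf representations P appends the digit 0. A maximal repetition of period m
-- and length at least 3m − 1 has block boundaries at its ends, so it is the φ-image of
-- a repetition of smaller period which again is that long; descending, every such
-- repetition comes from an occurrence of 00, the only kind of period 1. From the third
-- level on these repetitions have exponent at least 3, and the cubes of the one obtained
-- after q further steps from the 00 at o end exactly at the j with
--   P^q(P²(μ) + 1) ≤ j + 1  and  j + 3 ≤ P^q(P²(μ) + 3),  where μ = o + 3.
-- If (i)_F = u w then u = x0 with μ the value of x, and i + 1 = P^(|w| − 1)(P²(μ) + 1), so
-- the run consists of the cube ends of a single repetition, of length F_{|w|+2} − 1.
-- It is maximal unless one of its two bounds is strictly inside the interval of another
-- repetition. As P is strictly increasing, common powers of P cancel, and this would
-- force x to have a prefix y01 or y10 in which y also represents such a μ; the shape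
-- of x rules this out.
module Submission where

open import Defs
open import Data.Nat using (ℕ; zero; suc; _+_; _*_; _∸_; _≤_; _<_; z≤n; s≤s)
open import Data.Nat.Properties
open import Data.Nat.Tactic.RingSolver using (solve-∀)
open import Data.List using (List; []; _∷_; _++_; length; foldl; foldr; reverse)
open import Data.List.Properties using (concatMap-++; foldl-++; reverse-foldr)
open import Data.Bool using (Bool; true; false)
open import Data.Product using (Σ; _×_; _,_; proj₁; proj₂)
open import Data.Sum using (_⊎_; inj₁; inj₂; [_,_])
open import Data.Empty using (⊥; ⊥-elim)
open import Function using (flip)
open import Relation.Nullary using (¬_; yes; no)
open import Relation.Binary.PropositionalEquality hiding ([_])

-- Blocks of finite words and prefixes of the Fibonacci word

width : Bool → ℕ
width false = 2
width true  = 1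

blockStart : (ℕ → Bool) → ℕ → ℕ
blockStart w zero    = 0
blockStart w (suc n) = width (w n) + blockStart w n

pos : List Bool → ℕ → ℕ
pos _        zero    = 0
-- Default value; `pos` is only evaluated up to the length of the list.
pos []       (suc n) = 0
pos (x ∷ xs) (suc n) = width x + pos xs n

pos-suc : ∀ xs n → n < length xs → pos xs (suc n) ≡ width (at xs n) + pos xs n
pos-suc (x ∷ xs) zero    _       = refl
pos-suc (x ∷ xs) (suc n) (s≤s h) = begin
  width x + pos xs (suc n)               ≡⟨ cong (width x +_) (pos-suc xs n h) ⟩
  width x + (width (at xs n) + pos xs n) ≡⟨ +-assoc (width x) _ _ ⟨
  width x + width (at xs n) + pos xs n   ≡⟨ cong (_+ pos xs n) (+-comm (width x) _) ⟩
  width (at xs n) + width x + pos xs n   ≡⟨ +-assoc (width (at xs n)) _ _ ⟩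
  width (at xs n) + (width x + pos xs n) ∎
  where open ≡-Reasoning

at-φ-pos : ∀ xs n → n < length xs → at (φ xs) (pos xs n) ≡ false
at-φ-pos (false ∷ xs) zero    _       = refl
at-φ-pos (true  ∷ xs) zero    _       = refl
at-φ-pos (false ∷ xs) (suc n) (s≤s h) = at-φ-pos xs n h
at-φ-pos (true  ∷ xs) (suc n) (s≤s h) = at-φ-pos xs n h

at-φ-suc-pos : ∀ xs n → n < length xs → at xs n ≡ false → at (φ xs) (suc (pos xs n)) ≡ true
at-φ-suc-pos (false ∷ xs) zero    _       _ = refl
at-φ-suc-pos (false ∷ xs) (suc n) (s≤s h) e = at-φ-suc-pos xs n h e
at-φ-suc-pos (true  ∷ xs) (suc n) (s≤s h) e = at-φ-suc-pos xs n h e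

W : ℕ → List Bool
W k = φ^ k (false ∷ [])

length-φ : ∀ xs → length xs ≤ length (φ xs)
length-φ []           = z≤n
length-φ (false ∷ xs) = s≤s (m≤n⇒m≤1+n (length-φ xs))
length-φ (true  ∷ xs) = s≤s (length-φ xs)

W-head : ∀ k → Σ (List Bool) λ xs → W k ≡ false ∷ xs
W-head zero    = [] , refl
W-head (suc k) with W-head k
... | xs , e = true ∷ φ xs , cong φ e

length-W : ∀ k → k < length (W k)
length-W zero    = s≤s z≤n
length-W (suc k) with W k | W-head k | length-W k
... | _ | xs , refl | h = s≤s (≤-trans h (s≤s (length-φ xs)))

W-prefix : ∀ k → Σ (List Bool) λ xs → W (suc k) ≡ W k ++ xs
W-prefix zero    = true ∷ [] , refl
W-prefix (suc k) with W-prefix k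
... | xs , e = φ xs , trans (cong φ e) (concatMap-++ _ (W k) xs)

at-++ : ∀ xs ys n → n < length xs → at (xs ++ ys) n ≡ at xs n
at-++ (x ∷ xs) ys zero    _       = refl
at-++ (x ∷ xs) ys (suc n) (s≤s h) = at-++ xs ys n h

at-W-+ : ∀ n j → at (W (j + suc n)) n ≡ fibWord n
at-W-+ n zero    = refl
at-W-+ n (suc j) with W-prefix (j + suc n)
... | xs , e = trans (cong (λ ys → at ys n) e)
  (trans (at-++ (W (j + suc n)) xs n (<-trans (m≤n+m (suc n) j) (length-W (j + suc n)))) (at-W-+ n j))

at-W : ∀ n k → n < k → at (W k) n ≡ fibWord n
at-W n k h = subst (λ j → at (W j) n ≡ fibWord n) (m∸n+n≡m h) (at-W-+ n (k ∸ suc n))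

pos-W : ∀ n k → n ≤ k → pos (W k) n ≡ blockStart fibWord n
pos-W zero    k _ = refl
pos-W (suc n) k h = trans (pos-suc (W k) n (<-trans h (length-W k)))
  (cong₂ (λ b j → width b + j) (at-W n k h) (pos-W n k (<⇒≤ h)))

fib-blockStart : ∀ n → fibWord (blockStart fibWord n) ≡ false
fib-blockStart n = begin
  fibWord p                  ≡⟨ at-W p (suc K) (s≤s (m≤n+m p n)) ⟨
  at (W (suc K)) p           ≡⟨ cong (at (W (suc K))) (pos-W n K n≤K) ⟨
  at (φ (W K)) (pos (W K) n) ≡⟨ at-φ-pos (W K) n (≤-<-trans n≤K (length-W K)) ⟩
  false                      ∎
  where
  open ≡-Reasoning
  p K : ℕ
  p = blockStart fibWord n
  -- Large enough for `W K` to contain position `n` and for `W (suc K)` to contain position `p`.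
  K = n + p
  n≤K : n ≤ K
  n≤K = m≤m+n n p

fib-suc-blockStart : ∀ n → fibWord n ≡ false → fibWord (suc (blockStart fibWord n)) ≡ true
fib-suc-blockStart n fn = begin
  fibWord (suc p)                  ≡⟨ at-W (suc p) (suc K) (s≤s (s≤s (m≤n+m p n))) ⟨
  at (W (suc K)) (suc p)           ≡⟨ cong (λ j → at (W (suc K)) (suc j)) (pos-W n K (<⇒≤ n<K)) ⟨
  at (φ (W K)) (suc (pos (W K) n)) ≡⟨ at-φ-suc-pos (W K) n (<-trans n<K (length-W K)) (trans (at-W n K n<K) fn) ⟩
  true                             ∎
  where
  open ≡-Reasoning
  p K : ℕ
  p = blockStart fibWord n
  K = suc (n + p)
  n<K : n < K
  n<K = s≤s (m≤m+n n p)

0≢1 : ∀ {b : Bool} → b ≡ false → b ≡ true → ⊥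
0≢1 refl ()

-- Words fixed by the morphism and their block starts

module FixedPoint (w : ℕ → Bool)
  (w-P : ∀ n → w (blockStart w n) ≡ false)
  (w-1+P : ∀ n → w n ≡ false → w (suc (blockStart w n)) ≡ true) where

  P : ℕ → ℕ
  P = blockStart w

  P-suc-0 : ∀ {n} → w n ≡ false → P (suc n) ≡ 2 + P n
  P-suc-0 {n} e = cong (λ b → width b + P n) e

  P-suc-1 : ∀ {n} → w n ≡ true → P (suc n) ≡ 1 + P n
  P-suc-1 {n} e = cong (λ b → width b + P n) e

  letter : ∀ n → (w n ≡ false) ⊎ (w n ≡ true)
  letter n with w n
  ... | false = inj₁ refl
  ... | true  = inj₂ refl

  -- The images of 0 and 1 under φ² are 010 and 01, each one letter longer than under φ. This is the
  -- Fibonacci recurrence in the form used for digits.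
  P∘P : ∀ n → P (P n) ≡ P n + n
  P∘P zero    = refl
  P∘P (suc n) with letter n
  ... | inj₁ e rewrite P-suc-0 e | P-suc-1 (w-1+P n e) | P-suc-0 (w-P n) | P∘P n | +-suc (P n) n = refl
  ... | inj₂ e rewrite P-suc-1 e | P-suc-0 (w-P n) | P∘P n | +-suc (P n) n = refl

  data Block : ℕ → Set where
    start : ∀ k → Block (P k)
    inner : ∀ k → w k ≡ false → Block (suc (P k))

  block : ∀ n → Block n
  block zero    = start 0
  block (suc n) with block n
  ... | inner k e = subst Block (P-suc-0 e) (start (suc k))
  ... | start k with letter k
  ...   | inj₁ e = inner k e
  ...   | inj₂ e = subst Block (P-suc-1 e) (start (suc k))

  w-0⇒P : ∀ {n} → w n ≡ false → Σ ℕ λ k → n ≡ P k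
  w-0⇒P {n} e with block n
  ... | start k   = k , refl
  ... | inner k h = ⊥-elim (0≢1 e (w-1+P k h))

  w-1⇒1+P : ∀ {n} → w n ≡ true → Σ ℕ λ k → (n ≡ suc (P k)) × (w k ≡ false)
  w-1⇒1+P {n} e with block n
  ... | start k   = ⊥-elim (0≢1 (w-P k) e)
  ... | inner k h = k , refl , h

  w-1+P⁻¹ : ∀ n → w (suc (P n)) ≡ true → w n ≡ false
  w-1+P⁻¹ n e with letter n
  ... | inj₁ h = h
  ... | inj₂ h = ⊥-elim (0≢1 (trans (cong w (sym (P-suc-1 h))) (w-P (suc n))) e)

  w-1+P-0 : ∀ n → w n ≡ true → w (suc (P n)) ≡ false
  w-1+P-0 n e = trans (cong w (sym (P-suc-1 e))) (w-P (suc n))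

  no-11 : ∀ n → w n ≡ true → w (suc n) ≡ false
  no-11 n e with w-1⇒1+P e
  ... | k , refl , h = trans (cong w (sym (P-suc-0 h))) (w-P (suc k))

  -- The first of two adjacent zeros is a whole block, the image of a 1. The letter after that 1 is
  -- 0, so the second zero begins a block 01.
  no-000 : ∀ n → w n ≡ false → w (suc n) ≡ false → w (2 + n) ≡ true
  no-000 n e e' with w-0⇒P e
  ... | k , refl with letter k
  ...   | inj₁ h = ⊥-elim (0≢1 e' (w-1+P k h))
  ...   | inj₂ h = trans (cong (λ j → w (suc j)) (sym (P-suc-1 h))) (w-1+P (suc k) (no-11 k h))

  P-< : ∀ n → P n < P (suc n)
  P-< n with letter n
  ... | inj₁ e rewrite P-suc-0 e = s≤s (n≤1+n (P n))
  ... | inj₂ e rewrite P-suc-1 e = ≤-refl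

  P-mono-+ : ∀ m d → P m ≤ P (d + m)
  P-mono-+ m zero    = ≤-refl
  P-mono-+ m (suc d) = ≤-trans (P-mono-+ m d) (<⇒≤ (P-< (d + m)))

  P-mono-≤ : ∀ {m n} → m ≤ n → P m ≤ P n
  P-mono-≤ {m} {n} h = subst (λ j → P m ≤ P j) (m∸n+n≡m h) (P-mono-+ m (n ∸ m))

  P-mono-< : ∀ {m n} → m < n → P m < P n
  P-mono-< {m} h = <-≤-trans (P-< m) (P-mono-≤ h)

  P-cancel-< : ∀ {m n} → P m < P n → m < n
  P-cancel-< {m} {n} h with n ≤? m
  ... | yes n≤m = ⊥-elim (<-irrefl refl (<-≤-trans h (P-mono-≤ n≤m)))
  ... | no n≰m  = ≰⇒> n≰m

  P-cancel-≤ : ∀ {m n} → P m ≤ P n → m ≤ n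
  P-cancel-≤ {m} {n} h with m ≤? n
  ... | yes m≤n = m≤n
  ... | no m≰n  = ⊥-elim (<-irrefl refl (<-≤-trans (P-mono-< (≰⇒> m≰n)) h))

  P-injective : ∀ {m n} → P m ≡ P n → m ≡ n
  P-injective e = ≤-antisym (P-cancel-≤ (≤-reflexive e)) (P-cancel-≤ (≤-reflexive (sym e)))

  P-2+≥ : ∀ n → 3 + P n ≤ P (2 + n)
  P-2+≥ n with letter n
  ... | inj₁ e rewrite P-suc-0 e = ≤-trans ≤-refl (+-monoˡ-≤ (2 + P n) (width≥1 (w (suc n))))
    where
    width≥1 : ∀ b → 1 ≤ width b
    width≥1 false = s≤s z≤n
    width≥1 true  = s≤s z≤n
  ... | inj₂ e rewrite P-suc-0 (no-11 n e) | P-suc-1 e = ≤-refl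

  -- Periods and their images under the morphism

  -- The factor w[x .. x + l + m) has period m; l counts the matching pairs of letters.
  Period : ℕ → ℕ → ℕ → Set
  Period x m l = ∀ k → k < l → w (x + k) ≡ w (x + k + m)

  -- Matching letters have blocks of equal width, so the distance between corresponding block starts
  -- stays `M`.
  Period-P : ∀ {x m l M} → Period x m l → P (x + m) ≡ P x + M →
    ∀ k → k ≤ l → P (x + k + m) ≡ P (x + k) + M
  Period-P {x} {m} {l} {M} per e zero    _ rewrite +-identityʳ x = e
  Period-P {x} {m} {l} {M} per e (suc k) h = begin
    P (x + suc k + m)                          ≡⟨ cong (λ j → P (j + m)) (+-suc x k) ⟩
    width (w (x + k + m)) + P (x + k + m) ≡⟨ cong₂ (λ b j → width b + j) (sym (per k h)) (Period-P per e k (<⇒≤ h)) ⟩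
    width (w (x + k)) + (P (x + k) + M)  ≡⟨ +-assoc (width (w (x + k))) _ _ ⟨
    P (suc (x + k)) + M                        ≡⟨ cong (λ j → P j + M) (+-suc x k) ⟨
    P (x + suc k) + M                          ∎
    where open ≡-Reasoning

  within : ∀ x j → Σ ℕ λ k → (P x + j ≡ P (x + k)) ⊎ ((P x + j ≡ suc (P (x + k))) × (w (x + k) ≡ false))
  within x j = go (block (P x + j)) refl
    where
    go : ∀ {n} → Block n → P x + j ≡ n →
      Σ ℕ λ k → (P x + j ≡ P (x + k)) ⊎ ((P x + j ≡ suc (P (x + k))) × (w (x + k) ≡ false))
    go (start y) e = y ∸ x , inj₁ (trans e (cong P (sym (m+[n∸m]≡n x≤y))))
      where
      x≤y : x ≤ y
      x≤y = P-cancel-≤ {x} {y} (≤-trans (m≤m+n (P x) j) (≤-reflexive e))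
    go (inner y h) e = y ∸ x , inj₂ (trans e (cong (λ z → suc (P z)) (sym x+)) , trans (cong w x+) h)
      where
      x<sy : P x < P (suc y)
      x<sy = ≤-trans (s≤s (≤-trans (m≤m+n (P x) j) (≤-reflexive e))) (≤-reflexive (sym (P-suc-0 {y} h)))
      x+ : x + (y ∸ x) ≡ y
      x+ = m+[n∸m]≡n (≤-pred (P-cancel-< {x} {suc y} x<sy))

  -- A letter of the image is determined by its offset in its block and by the kind of block, and
  -- both recur after `M` letters. The last match is the first letter of block `x + l`: there
  -- `k ≤ l` suffices, whereas a second letter requires `k < l`.
  Period-φ : ∀ {x m l M L} → Period x m l → P (x + m) ≡ P x + M → P (x + l) ≡ P x + L →
    Period (P x) M (suc L)
  Period-φ {x} {m} {l} {M} {L} per eM eL j j≤L with within x j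
  ... | k , inj₁ e = trans (trans (cong w e) (w-P (x + k)))
      (sym (trans (cong w (trans (cong (_+ M) e) (sym (Period-P per eM k k≤l)))) (w-P (x + k + m))))
    where
    k≤l : k ≤ l
    k≤l = +-cancelˡ-≤ x k l (P-cancel-≤ {x + k} {x + l} (subst₂ _≤_ e (sym eL) (+-monoʳ-≤ (P x) (≤-pred j≤L))))
  ... | k , inj₂ (e , h) = trans (trans (cong w e) (w-1+P (x + k) h))
      (sym (trans (cong w (trans (cong (_+ M) e) (cong suc (sym (Period-P per eM k (<⇒≤ k<l))))))
        (w-1+P (x + k + m) (trans (sym (per k k<l)) h))))
    where
    k<l : k < l
    k<l = +-cancelˡ-< x k l (P-cancel-< {x + k} {x + l} (subst₂ _≤_ e (sym eL) (+-monoʳ-≤ (P x) (≤-pred j≤L))))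

  -- Repetitions generated by 00

  DoubleZero : ℕ → Set
  DoubleZero o = (w o ≡ false) × (w (suc o) ≡ false)

  -- Run o t s m l: the t-th φ-image of the 00 at o is the repetition w[s .. s + l + m) of
  -- period m. The image is one letter longer than its blocks, since the two blocks that
  -- break the period both start with 0.
  data Run (o : ℕ) : ℕ → ℕ → ℕ → ℕ → Set where
    base : Run o 0 o 1 1
    up   : ∀ {t s m l M L} → Run o t s m l →
           P (s + m) ≡ P s + M → P (s + l) ≡ P s + L → Run o (suc t) (P s) M (suc L)

  Run-period : ∀ {o t s m l} → DoubleZero o → Run o t s m l → Period s m l
  Run-period {o} (z , z′) base zero _ rewrite +-identityʳ o | +-comm o 1 = trans z (sym z′)
  Run-period zz base (suc k) (s≤s ())
  Run-period zz (up r eM eL) = Period-φ (Run-period zz r) eM eL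

  P-diff : ∀ x k → Σ ℕ λ d → P (x + k) ≡ P x + d
  P-diff x k = P (x + k) ∸ P x , sym (m+[n∸m]≡n (P-mono-≤ (m≤m+n x k)))

  P^ : ℕ → ℕ → ℕ
  P^ zero    n = n
  P^ (suc k) n = P (P^ k n)

  run : ∀ o t → Σ ℕ λ m → Σ ℕ λ l → Run o t (P^ t o) m l
  run o zero    = 1 , 1 , base
  run o (suc t) with run o t
  ... | m , l , r = _ , _ , up r (proj₂ (P-diff (P^ t o) m)) (proj₂ (P-diff (P^ t o) l))

  -- The prefix of length n ends with 01 or 10. The two letters after a repetition are of
  -- this kind, which makes the position after them stable under P.
  Mixed : ℕ → Set
  Mixed n = Σ ℕ λ j → (n ≡ 2 + j) ×
    ((w j ≡ false) × (w (suc j) ≡ true) ⊎ (w j ≡ true) × (w (suc j) ≡ false))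

  P-mixed : ∀ j → Mixed (2 + j) → P (2 + j) ≡ 3 + P j
  P-mixed j (_ , refl , inj₁ (a , b)) = trans (P-suc-1 b) (cong suc (P-suc-0 a))
  P-mixed j (_ , refl , inj₂ (a , b)) = trans (P-suc-0 b) (cong (2 +_) (P-suc-1 a))

  -- The image of 01 is 010, which ends with 10, and that of 10 is 001, which ends with 01.
  Mixed-P : ∀ {n} → Mixed n → Mixed (P n)
  Mixed-P (j , refl , inj₁ (a , b)) = suc (P j) , trans (P-suc-1 b) (cong suc (P-suc-0 a)) ,
    inj₂ (w-1+P j a , trans (cong w (sym (P-suc-0 a))) (w-P (suc j)))
  Mixed-P (j , refl , inj₂ (a , b)) = P (suc j) , P-suc-0 b , inj₁ (w-P (suc j) , w-1+P (suc j) b)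

  -- Invariant of the repetitions from the second level on, with `q` counting the further images.
  -- `first` locates the end of the leftmost cube; `end` is two letters beyond the repetition, where
  -- the position is carried along by `P`.
  record Cubic (o q s m l : ℕ) : Set where
    constructor cubic
    field
      long   : m + m ≤ l
      first  : s + 3 * m ≡ P^ q (1 + P (P (3 + o)))
      end    : 2 + (s + l + m) ≡ P^ q (3 + P (P (3 + o)))
      mixed  : Mixed (2 + (s + l + m))

  Cubic-φ : ∀ {o q s m l M L} → Period s m l → P (s + m) ≡ P s + M → P (s + l) ≡ P s + L →
    Cubic o q s m l → Cubic o (suc q) (P s) M (suc L)
  Cubic-φ {s = s} {m} {l} {M} {L} per eM eL (cubic long first end mixed) =
    cubic (m≤n⇒m≤1+n M+M≤L) first′ (trans (sym e+) (cong P end)) (subst Mixed e+ (Mixed-P mixed))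
    where
    open ≡-Reasoning
    2m : P (s + (m + m)) ≡ P s + (M + M)
    2m = begin
      P (s + (m + m)) ≡⟨ cong P (+-assoc s m m) ⟨
      P (s + m + m)   ≡⟨ Period-P per eM m (≤-trans (m≤m+n m m) long) ⟩
      P (s + m) + M   ≡⟨ cong (_+ M) eM ⟩
      P s + M + M     ≡⟨ +-assoc (P s) M M ⟩
      P s + (M + M)   ∎
    M+M≤L : M + M ≤ L
    M+M≤L = +-cancelˡ-≤ (P s) (M + M) L (subst₂ _≤_ 2m eL (P-mono-≤ (+-monoʳ-≤ s long)))
    triple : ∀ a b → a + 3 * b ≡ a + (b + b) + b
    triple = solve-∀
    first′ : P s + 3 * M ≡ _
    first′ = begin
      P s + 3 * M         ≡⟨ triple (P s) M ⟩
      P s + (M + M) + M   ≡⟨ cong (_+ M) 2m ⟨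
      P (s + (m + m)) + M ≡⟨ Period-P per eM (m + m) long ⟨
      P (s + (m + m) + m) ≡⟨ cong P (triple s m) ⟨
      P (s + 3 * m)       ≡⟨ cong P first ⟩
      _                   ∎
    -- The blocks of the two mixed letters have three letters in all. One of them is the extra match
    -- in `suc L`, so the offset is two again.
    e+ : P (2 + (s + l + m)) ≡ 2 + (P s + suc L + M)
    e+ = begin
      P (2 + (s + l + m))       ≡⟨ P-mixed (s + l + m) mixed ⟩
      3 + P (s + l + m)         ≡⟨ cong (3 +_) (Period-P per eM l ≤-refl) ⟩
      3 + (P (s + l) + M)       ≡⟨ cong (λ j → 3 + (j + M)) eL ⟩
      3 + (P s + L + M)         ≡⟨ cong (λ j → 2 + (j + M)) (+-suc (P s) L) ⟨
      2 + (P s + suc L + M)     ∎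

  P-diff-unique : ∀ x k {d d′} → P (x + k) ≡ P x + d → P (k + x) ≡ d′ + P x → d ≡ d′
  P-diff-unique x k {d} {d′} e e′ = +-cancelˡ-≡ (P x) d d′
    (trans (sym e) (trans (cong P (+-comm x k)) (trans e′ (+-comm d′ (P x)))))

  -- The repetition is 01010, one letter short of a cube.
  Run-level1 : ∀ {o s m l} → DoubleZero o → Run o 1 s m l → (s ≡ P o) × (m ≡ 2) × (l ≡ 3)
  Run-level1 {o} (z , _) (up base eM eL) =
    refl , P-diff-unique o 1 eM (P-suc-0 z) , cong suc (P-diff-unique o 1 eL (P-suc-0 z))

  module _ {o : ℕ} (zz : DoubleZero o) where
    z : w o ≡ false
    z = proj₁ zz

    z′ : w (suc o) ≡ false
    z′ = proj₂ zz

    P-2+o : P (2 + o) ≡ 4 + P o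
    P-2+o = trans (P-suc-0 z′) (cong (2 +_) (P-suc-0 z))

    P-3+o : P (3 + o) ≡ 5 + P o
    P-3+o = trans (P-suc-1 (no-000 o z z′)) (cong suc P-2+o)

    PP-2+ : P (2 + P o) ≡ 3 + P (P o)
    PP-2+ = trans (P-suc-1 (w-1+P o z)) (cong suc (P-suc-0 (w-P o)))

    w-2+Po : w (2 + P o) ≡ false
    w-2+Po = trans (cong w (sym (P-suc-0 z))) (w-P (suc o))

    PP-3+ : P (3 + P o) ≡ 5 + P (P o)
    PP-3+ = trans (P-suc-0 w-2+Po) (cong (2 +_) PP-2+)

    -- The letters from `o` on are 001, and their image under φ² is 01001001.
    PP-3+o : P (P (3 + o)) ≡ 8 + P (P o)
    PP-3+o = begin
      P (P (3 + o))   ≡⟨ cong P P-3+o ⟩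
      P (5 + P o)     ≡⟨ P-suc-0 (trans (cong w (sym P-2+o)) (w-P (2 + o))) ⟩
      2 + P (4 + P o) ≡⟨ cong (2 +_) (P-suc-1 (trans (cong (λ j → w (suc j)) (sym (P-suc-0 z))) (w-1+P (suc o) z′))) ⟩
      3 + P (3 + P o) ≡⟨ cong (3 +_) PP-3+ ⟩
      8 + P (P o)     ∎
      where open ≡-Reasoning

    -- The repetition is 010010010, a single cube of period 3, followed by 10.
    Run-level2 : ∀ {s m l} → Run o 2 s m l → Cubic o 0 s m l
    Run-level2 (up r eM eL) with Run-level1 zz r
    ... | refl , refl , refl with P-diff-unique (P o) 2 eM PP-2+ | P-diff-unique (P o) 3 eL PP-3+
    ...   | refl | refl = cubic ≤-refl
      (trans (+-comm (P (P o)) 9) (cong suc (sym PP-3+o)))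
      (trans eleven (cong (3 +_) (sym PP-3+o)))
      (subst Mixed (sym (trans eleven (cong (3 +_) (sym PP-3+o))))
        (1 + P (P (3 + o)) , refl , inj₂ (w-1+P _ w-μ , trans (cong w (sym (P-suc-0 w-μ))) (w-P _))))
      where
      w-μ : w (P (3 + o)) ≡ false
      w-μ = w-P (3 + o)
      eleven : 2 + (P (P o) + 6 + 3) ≡ 11 + P (P o)
      eleven = trans (cong (2 +_) (+-assoc (P (P o)) 6 3)) (cong (2 +_) (+-comm (P (P o)) 9))

    Run-cubic : ∀ q {s m l} → Run o (2 + q) s m l → Cubic o q s m l
    Run-cubic zero    r            = Run-level2 r
    Run-cubic (suc q) (up r eM eL) = Cubic-φ (Run-period zz r) eM eL (Run-cubic q r)

  -- Desubstitution of repetitions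

  Found : ℕ → ℕ → ℕ → Set
  Found x m l = Σ ℕ λ o → Σ ℕ λ t → Σ ℕ λ s → Σ ℕ λ L →
    DoubleZero o × Run o t s m L × (s ≤ x) × (x + l ≤ s + L)

  -- Two blocks are told apart by the letter after their initial 0: it is 1 for the block 01 and 0
  -- for the block 0. The matches therefore end either at a block boundary or one letter into block
  -- `x + n`, whose kind is still open.
  walk : ∀ x m {M} l → P (x + m) ≡ P x + M → Period (P x) M l → Σ ℕ λ n → Period x m n ×
    ((P (x + n) ≡ P x + l) ⊎ (suc (P (x + n)) ≡ P x + l))
  walk x m zero eM per = 0 , (λ _ ()) , inj₁ (trans (cong P (+-identityʳ x)) (sym (+-identityʳ (P x))))
  walk x m {M} (suc l) eM per with walk x m l eM (λ k h → per k (m≤n⇒m≤1+n h))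
  ... | n , pn , inj₁ e = n , pn , inj₂ (trans (cong suc e) (sym (+-suc (P x) l)))
  ... | n , pn , inj₂ e = extend (letter (x + n))
    where
    y y′ : ℕ
    y  = x + n
    y′ = x + n + m
    match : w (suc (P y)) ≡ w (suc (P y′))
    match = trans (cong w e) (trans (per l ≤-refl)
      (cong w (trans (cong (_+ M) (sym e)) (cong suc (sym (Period-P pn eM n ≤-refl))))))
    longer : w y ≡ w y′ → Period x m (suc n)
    longer h k k<1+n with m≤n⇒m<n∨m≡n (≤-pred k<1+n)
    ... | inj₁ k<n  = pn k k<n
    ... | inj₂ refl = h
    extend : (w y ≡ false) ⊎ (w y ≡ true) → Σ ℕ λ n → Period x m n ×
      ((P (x + n) ≡ P x + suc l) ⊎ (suc (P (x + n)) ≡ P x + suc l))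
    extend (inj₁ h) = suc n , longer (trans h (sym (w-1+P⁻¹ y′ (trans (sym match) (w-1+P y h))))) ,
      inj₁ (begin
        P (x + suc n)     ≡⟨ cong P (+-suc x n) ⟩
        P (suc (x + n))   ≡⟨ P-suc-0 h ⟩
        2 + P (x + n)     ≡⟨ cong suc e ⟩
        suc (P x + l)     ≡⟨ +-suc (P x) l ⟨
        P x + suc l       ∎)
      where open ≡-Reasoning
    extend (inj₂ h) = suc n , longer (trans h (sym h′)) ,
      inj₂ (begin
        suc (P (x + suc n))   ≡⟨ cong (λ j → suc (P j)) (+-suc x n) ⟩
        suc (P (suc (x + n))) ≡⟨ cong suc (P-suc-1 h) ⟩
        2 + P (x + n)         ≡⟨ cong suc e ⟩
        suc (P x + l)         ≡⟨ +-suc (P x) l ⟨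
        P x + suc l           ∎)
      where
      open ≡-Reasoning
      h′ : w y′ ≡ true
      h′ with letter y′
      ... | inj₂ q = q
      ... | inj₁ q = ⊥-elim (0≢1 (trans (sym match) (w-1+P-0 y h)) (w-1+P y′ q) )

  -- Otherwise at least two of the letters of two full periods would be missing, and
  -- their blocks have total length at least 3.
  long-preimage : ∀ x m {M} l n → P (x + m) ≡ P x + M → Period x m n → 2 ≤ M →
    M + M ≤ suc l → P x + l ≤ suc (P (x + n)) → m + m ≤ suc n
  long-preimage x m {M} l n eM pn 2≤M 2M≤ hl with m + m ≤? suc n
  ... | yes h = h
  ... | no h with m ≤? n
  ...   | no m≰n = ⊥-elim (<-irrefl refl (<-≤-trans 2≤M (+-cancelˡ-≤ (P x + M) M 1 lem)))
    where
    open ≤-Reasoning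
    lem : P x + M + M ≤ P x + M + 1
    lem = begin
      P x + M + M          ≡⟨ +-assoc (P x) M M ⟩
      P x + (M + M)        ≤⟨ +-monoʳ-≤ (P x) 2M≤ ⟩
      P x + suc l          ≡⟨ +-suc (P x) l ⟩
      suc (P x + l)        ≤⟨ s≤s hl ⟩
      2 + P (x + n)        ≤⟨ s≤s (P-mono-< (+-monoʳ-< x (≰⇒> m≰n))) ⟩
      suc (P (x + m))      ≡⟨ cong suc eM ⟩
      suc (P x + M)        ≡⟨ +-comm 1 (P x + M) ⟩
      P x + M + 1          ∎
  ...   | yes m≤n with m≤n⇒∃ m≤n
    where
    m≤n⇒∃ : m ≤ n → Σ ℕ λ j → n ≡ j + m
    m≤n⇒∃ h = n ∸ m , sym (m∸n+n≡m h)
  ...     | j , refl = ⊥-elim (<-irrefl refl (≤-trans (P-2+≥ (x + j)) (+-cancelʳ-≤ M _ _ lem)))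
    where
    open ≤-Reasoning
    shape : ∀ a b → a + (b + b) ≡ a + b + b
    shape = solve-∀
    j+2≤m : 2 + j ≤ m
    j+2≤m = +-cancelʳ-≤ m (2 + j) m (≰⇒> h)
    lem : P (2 + (x + j)) + M ≤ 2 + P (x + j) + M
    lem = begin
      P (2 + (x + j)) + M      ≤⟨ +-monoˡ-≤ M (P-mono-≤ (≤-trans (≤-reflexive (sym (trans (+-suc x (suc j)) (cong suc (+-suc x j))))) (+-monoʳ-≤ x j+2≤m))) ⟩
      P (x + m) + M            ≡⟨ cong (_+ M) eM ⟩
      P x + M + M              ≡⟨ shape (P x) M ⟨
      P x + (M + M)            ≤⟨ +-monoʳ-≤ (P x) 2M≤ ⟩
      P x + suc l              ≡⟨ +-suc (P x) l ⟩
      suc (P x + l)            ≤⟨ s≤s hl ⟩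
      2 + P (x + (j + m))      ≡⟨ cong (λ i → 2 + P i) (+-assoc x j m) ⟨
      2 + P (x + j + m)        ≡⟨ cong (2 +_) (Period-P pn eM j (m≤m+n j m)) ⟩
      2 + P (x + j) + M        ∎

  P-expands : ∀ x m → 1 ≤ m → m < 2 ⊎ (suc m + P x ≤ P (m + x))
  P-expands x 1             _ = inj₁ ≤-refl
  P-expands x 2             _ = inj₂ (P-2+≥ x)
  P-expands x (suc (suc (suc m))) _ with P-expands x (2 + m) (s≤s z≤n)
  ... | inj₁ (s≤s (s≤s ()))
  ... | inj₂ h = inj₂ (≤-trans (s≤s h) (P-< (2 + m + x)))

  -- Termination of the descent. Only a period consisting of one block 0 would fail to shrink, and
  -- `2 ≤ M` excludes it.
  period-decreases : ∀ x m {M} → P (x + m) ≡ P x + M → 1 ≤ m → 2 ≤ M → m < M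
  period-decreases x m {M} eM 1≤m 2≤M with P-expands x m 1≤m
  ... | inj₁ m<2 = <-≤-trans m<2 2≤M
  ... | inj₂ h   = +-cancelʳ-≤ (P x) (suc m) M
    (≤-trans h (≤-reflexive (trans (cong P (+-comm m x)) (trans eM (+-comm (P x) M)))))

  -- The extra letter in `suc L′` covers the letter that may be left over by `walk`. The period of
  -- the image can be measured at `x` instead of `s`, since block starts keep their distance
  -- throughout the repetition.
  Found-φ : ∀ {x m n M} l → Period x m n → P (x + m) ≡ P x + M → P x + l ≤ suc (P (x + n)) →
    Found x m n → Found (P x) M l
  Found-φ {x} {m} {n} {M} l pn eM hl (o , t , s , L , zz , r , s≤x , le) =
    o , suc t , P s , suc L′ , zz , up r eM′ eL , P-mono-≤ s≤x ,
    ≤-trans hl (≤-trans (s≤s (P-mono-≤ le)) (≤-reflexive (trans (cong suc eL) (sym (+-suc (P s) L′)))))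
    where
    L′ : ℕ
    L′ = proj₁ (P-diff s L)
    eL : P (s + L) ≡ P s + L′
    eL = proj₂ (P-diff s L)
    N : ℕ
    N = proj₁ (P-diff s m)
    x≡ : s + (x ∸ s) ≡ x
    x≡ = m+[n∸m]≡n s≤x
    x-s≤L : x ∸ s ≤ L
    x-s≤L = +-cancelˡ-≤ s (x ∸ s) L (≤-trans (≤-reflexive x≡) (≤-trans (m≤m+n x n) le))
    N≡M : N ≡ M
    N≡M = +-cancelˡ-≡ (P x) N M (trans
      (sym (subst (λ y → P (y + m) ≡ P y + N) x≡
        (Period-P (Run-period zz r) (proj₂ (P-diff s m)) (x ∸ s) x-s≤L))) eM)
    eM′ : P (s + m) ≡ P s + M
    eM′ = trans (proj₂ (P-diff s m)) (cong (P s +_) N≡M)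

  -- The slack of one letter in m + m ≤ suc l is what survives desubstitution; b bounds the
  -- recursion on the period.
  desubstitute : ∀ b x m l → m ≤ b → 1 ≤ m → m + m ≤ suc l → Period x m l → Found x m l
  desubstitute zero x m l m≤b 1≤m _ _ = ⊥-elim (<-irrefl refl (≤-trans 1≤m m≤b))
  desubstitute (suc b) x 1 zero m≤b 1≤m (s≤s ()) per
  desubstitute (suc b) x 1 (suc l) m≤b 1≤m _ per = single l per
    where
    at0 : ∀ l → Period x 1 (suc l) → w x ≡ w (suc x)
    at0 l per = trans (cong w (sym (+-identityʳ x)))
      (trans (per 0 (s≤s z≤n)) (cong w (trans (cong (_+ 1) (+-identityʳ x)) (+-comm x 1))))
    both0 : w x ≡ w (suc x) → DoubleZero x
    both0 e with letter x
    ... | inj₁ h = h , trans (sym e) h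
    ... | inj₂ h = ⊥-elim (0≢1 (no-11 x h) (trans (sym e) h))
    single : ∀ l → Period x 1 (suc l) → Found x 1 (suc l)
    single zero per = x , 0 , x , 1 , both0 (at0 0 per) , base , ≤-refl , ≤-refl
    -- Three equal letters would be 000.
    single (suc l) per with both0 (at0 (suc l) per)
    ... | z , z′ = ⊥-elim (0≢1 (trans (sym at1) z′) (no-000 x z z′))
      where
      at1 : w (suc x) ≡ w (2 + x)
      at1 = trans (cong w (+-comm 1 x)) (trans (per 1 (s≤s (s≤s z≤n)))
        (cong w (trans (+-assoc x 1 1) (+-comm x 2))))
  desubstitute (suc b) x m@(suc (suc _)) zero m≤b 1≤m (s≤s ()) per
  desubstitute (suc b) x m@(suc (suc m-2)) l@(suc l-1) m≤b 1≤m 2m≤ per = go (letter x)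
    where
    x∼x+m : w x ≡ w (x + m)
    x∼x+m = trans (cong w (sym (+-identityʳ x)))
      (trans (per 0 (s≤s z≤n)) (cong (λ i → w (i + m)) (+-identityʳ x)))
    aligned : ∀ y y′ l → P y + m ≡ P y′ → m + m ≤ suc l → Period (P y) m l → Found (P y) m l
    aligned y y′ l e 2m≤ per with walk y (y′ ∸ y) {m} l eM per
      where
      y≤y′ : y ≤ y′
      y≤y′ = P-cancel-≤ (≤-trans (m≤m+n (P y) m) (≤-reflexive e))
      eM : P (y + (y′ ∸ y)) ≡ P y + m
      eM = trans (cong P (m+[n∸m]≡n y≤y′)) (sym e)
    ... | n , pn , stop = Found-φ l pn eM hl
        (desubstitute b y m′ n (≤-pred (≤-trans (period-decreases y m′ eM 1≤m′ 2≤m) m≤b)) 1≤m′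
          (long-preimage y m′ l n eM pn 2≤m 2m≤ hl) pn)
      where
      m′ : ℕ
      m′ = y′ ∸ y
      2≤m : 2 ≤ m
      2≤m = s≤s (s≤s z≤n)
      y<y′ : y < y′
      y<y′ = P-cancel-< (≤-trans (m<m+n (P y) {m} (s≤s z≤n)) (≤-reflexive e))
      1≤m′ : 1 ≤ m′
      1≤m′ = m<n⇒0<n∸m y<y′
      eM : P (y + m′) ≡ P y + m
      eM = trans (cong P (m+[n∸m]≡n (<⇒≤ y<y′))) (sym e)
      hl : P y + l ≤ suc (P (y + n))
      hl = [ (λ q → ≤-trans (≤-reflexive (sym q)) (n≤1+n _)) , (λ q → ≤-reflexive (sym q)) ] stop
    go : (w x ≡ false) ⊎ (w x ≡ true) → Found x m l
    go (inj₁ h) with w-0⇒P h | w-0⇒P (trans (sym x∼x+m) h)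
    ... | y , refl | y′ , e = aligned y y′ l e 2m≤ per
    -- A window that starts with 1 is extended to the left by one letter, to the start of a block
    -- 01; its copy `m` letters later extends likewise.
    go (inj₂ h) with w-1⇒1+P h | w-1⇒1+P (trans (sym x∼x+m) h)
    ... | y , refl , w-y | y′ , e , w-y′ = weaken
      (aligned y y′ (suc l) (suc-injective e) (m≤n⇒m≤1+n 2m≤) per′)
      where
      per′ : Period (P y) m (suc l)
      per′ zero _ = trans (cong w (+-identityʳ (P y)))
        (trans (trans (w-P y) (sym (trans (cong w (suc-injective e)) (w-P y′)))) (cong (λ i → w (i + m)) (sym (+-identityʳ (P y)))))
      per′ (suc k) (s≤s h) rewrite +-suc (P y) k = per k h
      weaken : Found (P y) m (suc l) → Found (suc (P y)) m l
      weaken (o , t , s , L , zz , r , le , le′) = o , t , s , L , zz , r , m≤n⇒m≤1+n le ,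
        ≤-trans (≤-reflexive (sym (+-suc (P y) l))) le′

  -- Cube ends as intervals

  -- Unfolds to `CubeEndsAt` when `w` is `fibWord`.
  CubeAt : ℕ → Set
  CubeAt j = Σ ℕ λ i → Σ ℕ λ m → (1 ≤ m) × (j + 1 ≡ i + 3 * m) ×
    (∀ k → k < m → (w (i + k) ≡ w (i + m + k)) × (w (i + k) ≡ w (i + 2 * m + k)))

  Run-positive : ∀ {o t s m l} → Run o t s m l → 1 ≤ m
  Run-positive base = s≤s z≤n
  Run-positive (up {s = s} {m} {M = M} r eM _) = +-cancelˡ-< (P s) 0 M
    (≤-trans (≤-reflexive (cong suc (+-identityʳ (P s))))
      (≤-trans (P-mono-< (m<m+n s (Run-positive r))) (≤-reflexive eM)))

  -- The bounds for the shortest cubes, of period 3.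
  lower upper : ℕ → ℕ
  lower μ = 1 + P (P μ)
  upper μ = 3 + P (P μ)

  -- Equivalently, the prefix of length μ ends with 001, as 000 does not occur.
  After001 : ℕ → Set
  After001 μ = Σ ℕ λ o → DoubleZero o × (μ ≡ 3 + o)

  between⇒cube : ∀ {μ} q j → After001 μ → P^ q (lower μ) ≤ 1 + j → 3 + j ≤ P^ q (upper μ) → CubeAt j
  between⇒cube q j (o , zz , refl) lo hi with run o (2 + q)
  ... | m , l , r with Run-cubic zz q r
  ...   | cubic long first end _ = s + d , m , Run-positive r , j+1≡ , λ k k<m →
          trans (cong w (+-assoc s d k)) (trans (per (d + k) (in-window k (≤-trans k<m (m≤m+n m m)))) (cong w (shape₁ s d k m))) ,
          trans (cong w (+-assoc s d k)) (trans (per (d + k) (in-window k (≤-trans k<m (m≤m+n m m))))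
            (trans (cong w (shape₂ s d k m)) (trans (per (d + (m + k)) (in-window (m + k) (+-monoʳ-< m k<m)))
              (cong w (shape₃ s d k m)))))
    where
    s d : ℕ
    s = P^ (2 + q) o
    -- Displacement of the required cube from the leftmost cube of the repetition.
    d = 1 + j ∸ (s + 3 * m)
    per : Period s m l
    per = Run-period zz r
    e+ : s + 3 * m + d ≡ 1 + j
    e+ = m+[n∸m]≡n (≤-trans (≤-reflexive first) lo)
    shape₀ : ∀ s d m → s + d + 3 * m ≡ s + 3 * m + d
    shape₀ = solve-∀
    shape₁ : ∀ s d k m → s + (d + k) + m ≡ s + d + m + k
    shape₁ = solve-∀
    shape₂ : ∀ s d k m → s + (d + k) + m ≡ s + (d + (m + k))
    shape₂ = solve-∀
    shape₃ : ∀ s d k m → s + (d + (m + k)) + m ≡ s + d + 2 * m + k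
    shape₃ = solve-∀
    shape₄ : ∀ s d m → (s + m) + (d + (m + m)) ≡ s + 3 * m + d
    shape₄ = solve-∀
    shape₅ : ∀ s l m → s + l + m ≡ s + m + l
    shape₅ = solve-∀
    j+1≡ : j + 1 ≡ s + d + 3 * m
    j+1≡ = trans (+-comm j 1) (trans (sym e+) (sym (shape₀ s d m)))
    d+2m≤l : d + (m + m) ≤ l
    d+2m≤l = +-cancelˡ-≤ (s + m) (d + (m + m)) l (≤-trans (≤-reflexive (trans (shape₄ s d m) e+))
      (≤-trans (≤-pred (≤-pred (≤-trans hi (≤-reflexive (sym end))))) (≤-reflexive (shape₅ s l m))))
    in-window : ∀ k → k < m + m → d + k < l
    in-window k h = ≤-trans (+-monoʳ-< d h) d+2m≤l

  cube⇒between : ∀ j → CubeAt j → Σ ℕ λ ν → Σ ℕ λ q →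
    After001 ν × (P^ q (lower ν) ≤ 1 + j) × (3 + j ≤ P^ q (upper ν))
  cube⇒between j (i , m , 1≤m , e , h) with desubstitute m i m (m + m) ≤-refl 1≤m (n≤1+n _) per
    where
    per : Period i m (m + m)
    per k k<2m with k <? m
    ... | yes k<m = trans (proj₁ (h k k<m)) (cong w (shape i m k))
      where
      shape : ∀ i m k → i + m + k ≡ i + k + m
      shape = solve-∀
    ... | no k≮m with k ∸ m | m+[n∸m]≡n (≮⇒≥ k≮m)
    ...   | k′ | refl = trans (cong w (sym (+-assoc i m k′))) (trans (sym (proj₁ (h k′ k′<m)))
              (trans (proj₂ (h k′ k′<m)) (cong w (shape i m k′))))
      where
      k′<m : k′ < m
      k′<m = +-cancelˡ-< m k′ m k<2m
      shape : ∀ i m k → i + 2 * m + k ≡ i + (m + k) + m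
      shape = solve-∀
  ... | o , t , s , L , zz , r , s≤i , le = classify t r
    where
    2m≤L : m + m ≤ L
    2m≤L = +-cancelˡ-≤ s (m + m) L (≤-trans (+-monoˡ-≤ (m + m) s≤i) le)
    shape : ∀ i m → i + (m + m) + m ≡ i + 3 * m
    shape = solve-∀
    -- Levels 0 and 1, the words 00 and 01010, are too short to contain a cube of their period.
    classify : ∀ t → Run o t s m L → Σ ℕ λ ν → Σ ℕ λ q →
      After001 ν × (P^ q (lower ν) ≤ 1 + j) × (3 + j ≤ P^ q (upper ν))
    classify zero base = ⊥-elim (absurd 2m≤L)
      where
      absurd : ¬ (2 ≤ 1)
      absurd (s≤s ())
    classify (suc zero) r with Run-level1 zz r
    ... | _ , refl , refl = ⊥-elim (absurd 2m≤L)
      where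
      absurd : ¬ (4 ≤ 3)
      absurd (s≤s (s≤s (s≤s ())))
    classify (suc (suc q)) r with Run-cubic zz q r
    ... | cubic _ first end _ = 3 + o , q , (o , zz , refl) ,
      ≤-trans (≤-reflexive (sym first)) (≤-trans (+-monoˡ-≤ (3 * m) s≤i) (≤-reflexive (trans (sym e) (+-comm j 1)))) ,
      ≤-trans (s≤s (s≤s (≤-trans (≤-reflexive (trans (+-comm 1 j) (trans e (sym (shape i m))))) (+-monoˡ-≤ m le))))
        (≤-reflexive end)

  -- Maximality of the runs

  -- For `n = 2 + j` these are the two bounds on a cube end `j`, made strict so that `P` can be
  -- cancelled on both sides.
  Inside : ℕ → ℕ → ℕ → Set
  Inside q ν n = (P^ q (lower ν) < n) × (n < P^ q (upper ν))

  Inside-P⁻¹ : ∀ {q ν n} → Inside (suc q) ν (P n) → Inside q ν n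
  Inside-P⁻¹ (a , b) = P-cancel-< a , P-cancel-< b

  After001-0 : ∀ {μ} → After001 μ → w μ ≡ false
  After001-0 (o , (z , z′) , refl) = no-11 (2 + o) (no-000 o z z′)

  -- The prefix of length n ends with the letter b.
  Ends : Bool → ℕ → Set
  Ends b n = Σ ℕ λ j → (n ≡ suc j) × (w j ≡ b)

  Ends-1-P : ∀ {n} → Ends true n → Ends false (P n)
  Ends-1-P (j , refl , h) = P j , P-suc-1 h , w-P j

  Ends-0-P : ∀ {n} → Ends false n → Ends true (P n)
  Ends-0-P (j , refl , h) = suc (P j) , P-suc-0 h , w-1+P j h

  Ends-unique : ∀ {n} → Ends true n → Ends false n → ⊥
  Ends-unique (j , refl , h) (_ , refl , h′) = 0≢1 h′ h

  After001⇒Ends : ∀ {μ} → After001 μ → Ends true μ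
  After001⇒Ends (o , (z , z′) , refl) = 2 + o , refl , no-000 o z z′

  strictly-between : ∀ {n} x → 1 + x < n → n < 3 + x → n ≡ 2 + x
  strictly-between x a b = ≤-antisym (≤-pred b) a

  -- At `q = 0` the only interior point is `2 + P (P ν)`, which is `P (1 + P ν)`.
  middle : ∀ {x ν} → Inside 0 ν (P x) → x ≡ 1 + P ν
  middle {x} {ν} (a , b) = P-injective {x} {1 + P ν}
    (trans (strictly-between (P (P ν)) a b) (sym (P-suc-0 (w-P ν))))

  P≢1+P : ∀ {m n} → w n ≡ false → P m ≢ 1 + P n
  P≢1+P {m} {n} h e = 0≢1 (w-P m) (trans (cong w e) (w-1+P n h))

  -- In Zeckendorf digits: no prefix of n (including n) has the form y01 or y10 where
  -- y represents some ν with After001 ν.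
  Isolated : ℕ → Set
  Isolated n = ∀ q {ν} → After001 ν → ¬ (P^ q (lower ν) ≤ n × n < P^ q (upper ν))

  module _ {μ : ℕ} (aμ : After001 μ) (iso : Isolated μ) where

    -- Cancelling common powers of `P` leaves `r` or `q` zero. If `q` is zero, the letters at or
    -- before the positions exclude the single interior point; if `r` is zero and `q` is at least 2,
    -- two more cancellations contradict `iso`.
    lower-outside : ∀ r q {ν} → After001 ν → ¬ Inside q ν (P^ r (lower μ))
    lower-outside zero zero {ν} aν (a , b) = P≢1+P {1 + P ν} (w-P μ)
      (trans (P-suc-0 (w-P ν)) (sym (strictly-between (P (P ν)) a b)))
    lower-outside (suc r) (suc q) {ν} aν h = lower-outside r q aν (Inside-P⁻¹ {q} {ν} h)
    lower-outside (suc zero) zero {ν} aν h = Ends-unique (After001⇒Ends aν)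
      (subst (Ends false) Pμ≡ν (Ends-1-P (After001⇒Ends aμ)))
      where
      Pμ≡ν : P μ ≡ ν
      Pμ≡ν = P-injective (suc-injective (middle {lower μ} {ν} h))
    lower-outside (suc (suc r)) zero {ν} aν h =
      P≢1+P {P^ r (lower μ)} (After001-0 aν) (middle {P^ (suc r) (lower μ)} {ν} h)
    lower-outside zero (suc zero) {ν} aν (a , b) with m≤n⇒m<n∨m≡n (P-cancel-≤ {lower ν} {P μ} (≤-pred a))
    ... | inj₁ h = 0≢1 (After001-0 aμ) (trans (cong w μ≡) (w-1+P ν (After001-0 aν)))
      where
      μ≡ : μ ≡ 1 + P ν
      μ≡ = middle {μ} {ν} (h , P-cancel-< {P μ} {upper ν} (≤-trans (n≤1+n _) b))
    ... | inj₂ h = P≢1+P {μ} (w-P ν) (sym h)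
    lower-outside zero (suc (suc q)) {ν} aν (a , b) = iso q aν
      ( P-cancel-≤ {P^ q (lower ν)} (P-cancel-≤ {P (P^ q (lower ν))} {P μ} (≤-pred a))
      , P-cancel-< {μ} {P^ q (upper ν)} (P-cancel-< {P μ} (≤-trans (n≤1+n _) b)))

    -- The bound is put in the form given by `P^-upper`, which exposes two further powers of `P` for
    -- cancellation.
    upper-outside : ∀ r q {ν} → After001 ν → ¬ Inside q ν (P^ (2 + r) (suc μ))
    upper-outside r zero {ν} aν h = P≢1+P {P^ r (suc μ)} (After001-0 aν) (middle {P^ (suc r) (suc μ)} {ν} h)
    upper-outside (suc r) (suc q) {ν} aν h = upper-outside r q aν (Inside-P⁻¹ {q} {ν} h)
    upper-outside zero (suc zero) {ν} aν h = Ends-unique (After001⇒Ends aμ)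
      (subst (Ends false) (sym μ≡) (Ends-1-P (After001⇒Ends aν)))
      where
      μ≡ : μ ≡ P ν
      μ≡ = suc-injective (middle {suc μ} {ν} (Inside-P⁻¹ {zero} {ν} {P (suc μ)} h))
    upper-outside zero (suc (suc q)) {ν} aν h with Inside-P⁻¹ {q} {ν} {suc μ} (Inside-P⁻¹ {suc q} {ν} h)
    ... | a , b = iso q aν (≤-pred a , ≤-trans (n≤1+n _) b)

    P^-upper : ∀ r → P^ (2 + r) (suc μ) ≡ P^ r (upper μ)
    P^-upper zero    = trans (cong P (P-suc-0 (After001-0 aμ)))
      (trans (P-suc-1 (w-1+P μ (After001-0 aμ))) (cong suc (P-suc-0 (w-P μ))))
    P^-upper (suc r) = cong P (P^-upper r)

    no-cube : ∀ {j} n → (∀ q {ν} → After001 ν → ¬ Inside q ν n) → n ≡ 2 + j → ¬ CubeAt j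
    no-cube {j} n out refl c with cube⇒between j c
    ... | _ , q , aν , a , b = out q aν (s≤s a , b)

    -- The neighbours of the run, before `i` and at `i + ℓ`, correspond to the two bounds
    -- themselves, which lie strictly inside no interval.
    run-of-cubes : ∀ r i ℓ → 1 + i ≡ P^ r (lower μ) → 2 + (i + ℓ) ≡ P^ r (upper μ) →
      (∀ k → k < ℓ → CubeAt (i + k)) × ¬ CubeAt (i + ℓ) ×
      ((i ≡ 0) ⊎ (Σ ℕ λ p → (i ≡ suc p) × ¬ CubeAt p))
    run-of-cubes r i ℓ lo hi = cubes , no-cube (P^ (2 + r) (suc μ)) (upper-outside r) (trans (P^-upper r) (sym hi)) , before i lo
      where
      cubes : ∀ k → k < ℓ → CubeAt (i + k)
      cubes k k<ℓ = between⇒cube r (i + k) aμ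
        (≤-trans (≤-reflexive (sym lo)) (s≤s (m≤m+n i k)))
        (≤-trans (s≤s (s≤s (+-monoʳ-< i k<ℓ))) (≤-reflexive hi))
      before : ∀ i → 1 + i ≡ P^ r (lower μ) → (i ≡ 0) ⊎ (Σ ℕ λ p → (i ≡ suc p) × ¬ CubeAt p)
      before zero    _ = inj₁ refl
      before (suc p) e = inj₂ (p , refl , no-cube (P^ r (lower μ)) (lower-outside r) (sym e))

  -- Digit words and their values

  append : ℕ → Bool → ℕ
  append n false = P n
  append n true  = 1 + P n

  valLSD-+ : ∀ es k → valLSD es (2 + k) ≡ valLSD es (1 + k) + valLSD es k
  valLSD-+ []           k = refl
  valLSD-+ (false ∷ es) k = valLSD-+ es (1 + k)
  valLSD-+ (true  ∷ es) k = trans (cong (F (2 + k) +_) (valLSD-+ es (1 + k)))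
    (shape (F (1 + k)) (F k) (valLSD es (2 + k)) (valLSD es (1 + k)))
    where
    shape : ∀ a b c d → a + b + (c + d) ≡ a + c + (b + d)
    shape = solve-∀

  -- Moving every digit to the next weight is `P`. By induction the higher digits form a value of
  -- `P`, where the letter is 0, so a last digit 1 adds a block of length 2.
  P-valLSD : ∀ es → P (valLSD es 2) ≡ valLSD es 3
  P∘P-valLSD : ∀ es → P (P (valLSD es 2)) ≡ valLSD es 4

  P∘P-valLSD es = begin
    P (P (valLSD es 2))           ≡⟨ P∘P (valLSD es 2) ⟩
    P (valLSD es 2) + valLSD es 2 ≡⟨ cong (_+ valLSD es 2) (P-valLSD es) ⟩
    valLSD es 3 + valLSD es 2     ≡⟨ valLSD-+ es 2 ⟨
    valLSD es 4                   ∎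
    where open ≡-Reasoning

  P-valLSD []           = refl
  P-valLSD (false ∷ es) = trans (cong P (sym (P-valLSD es))) (P∘P-valLSD es)
  P-valLSD (true  ∷ es) = begin
    P (1 + valLSD es 3)           ≡⟨ cong (λ j → P (1 + j)) (P-valLSD es) ⟨
    P (1 + P (valLSD es 2))       ≡⟨ P-suc-0 (w-P (valLSD es 2)) ⟩
    2 + P (P (valLSD es 2))       ≡⟨ cong (2 +_) (P∘P-valLSD es) ⟩
    2 + valLSD es 4               ∎
    where open ≡-Reasoning

  valLSD-foldr : ∀ es → valLSD es 2 ≡ foldr (flip append) 0 es
  valLSD-foldr []           = refl
  valLSD-foldr (false ∷ es) = trans (sym (P-valLSD es)) (cong P (valLSD-foldr es))
  valLSD-foldr (true  ∷ es) = cong suc (trans (sym (P-valLSD es)) (cong P (valLSD-foldr es)))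

  val-foldl : ∀ ds → val ds ≡ foldl append 0 ds
  val-foldl ds = trans (valLSD-foldr (reverse ds)) (reverse-foldr (flip append) 0 ds)

  n≤P^ : ∀ q n → n ≤ P^ q n
  n≤P^ zero    n = ≤-refl
  n≤P^ (suc q) n = ≤-trans (n≤P^ q n) (n≤P (P^ q n))
    where
    n≤P : ∀ n → n ≤ P n
    n≤P zero    = z≤n
    n≤P (suc n) = ≤-<-trans (n≤P n) (P-< n)

  -- Values of the admissible prefixes

  Isolated-zero : Isolated 0
  Isolated-zero q {ν} _ (a , _) with ≤-trans (n≤P^ q (lower ν)) a
  ... | ()

  -- Appending 0 can create only a forbidden prefix y10, which the second hypothesis excludes; the
  -- case of larger `q` cancels one `P`.
  Isolated-P : ∀ {n} → Isolated n → (∀ {ν} → After001 ν → n ≢ 1 + P ν) → Isolated (P n)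
  Isolated-P {n} iso ne zero {ν} aν (a , b) with m≤n⇒m<n∨m≡n a
  ... | inj₁ h = ne aν (middle {n} {ν} (h , b))
  ... | inj₂ h = P≢1+P {n} (w-P ν) (sym h)
  Isolated-P iso ne (suc q) aν (a , b) = iso q aν (P-cancel-≤ a , P-cancel-< b)

  Isolated-P-0 : ∀ {n} → w n ≡ false → Isolated n → Isolated (P n)
  Isolated-P-0 h iso = Isolated-P iso λ {ν} aν e → 0≢1 h (trans (cong w e) (w-1+P ν (After001-0 aν)))

  -- Appending 1 can create only a forbidden prefix y01, and then `n` would be the value of y0.
  Isolated-1+P : ∀ {n} → w n ≡ false → Isolated n → (∀ {ν} → After001 ν → n ≢ P ν) → Isolated (1 + P n)
  Isolated-1+P {n} h iso ne zero {ν} aν (a , b) with m≤n⇒m<n∨m≡n a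
  ... | inj₁ h′ = P≢1+P {n} (w-P ν) (suc-injective (strictly-between (P (P ν)) h′ b))
  ... | inj₂ h′ = ne aν (P-injective (sym (suc-injective h′)))
  Isolated-1+P {n} h iso ne (suc q) {ν} aν (a , b) =
    iso q aν (≤-pred (P-cancel-< (≤-trans (s≤s a) (≤-reflexive (sym (P-suc-0 h))))) , P-cancel-< (≤-trans (n≤1+n _) b))

  Isolated-10 : ∀ {n} → w n ≡ false → Isolated n → ¬ After001 n → (∀ {ν} → After001 ν → n ≢ P ν) →
    Isolated (P (1 + P n))
  Isolated-10 h iso na ne = Isolated-P (Isolated-1+P h iso ne)
    λ aν e → na (subst After001 (sym (P-injective (suc-injective e))) aν)

  Ends01 : ℕ → Set
  Ends01 n = Σ ℕ λ j → (n ≡ 2 + j) × (w j ≡ false) × (w (suc j) ≡ true)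

  -- The image of 01 under φ² is 01001.
  After001-PP : ∀ {n} → Ends01 n → After001 (P (P n))
  After001-PP (j , refl , a , b) = 2 + P (P j) ,
    (trans (cong w (sym 2+)) (w-P (1 + P j)) , trans (cong (λ i → w (suc i)) (sym 2+)) (trans (cong w (sym 3+)) (w-P (2 + P j)))) ,
    (begin
      P (P (2 + j))       ≡⟨ cong P (trans (P-suc-1 b) (cong suc (P-suc-0 a))) ⟩
      P (3 + P j)         ≡⟨ P-suc-0 (trans (cong w (sym (P-suc-0 a))) (w-P (suc j))) ⟩
      2 + P (2 + P j)     ≡⟨ cong (2 +_) (trans 3+ (cong suc 2+)) ⟩
      3 + (2 + P (P j))   ∎)
    where
    open ≡-Reasoning
    2+ : P (1 + P j) ≡ 2 + P (P j)
    2+ = P-suc-0 (w-P j)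
    3+ : P (2 + P j) ≡ 1 + P (1 + P j)
    3+ = P-suc-1 (w-1+P j a)

  After001⇒Ends01 : ∀ {μ} → After001 μ → Ends01 μ
  After001⇒Ends01 (o , (z , z′) , refl) = 1 + o , refl , z′ , no-000 o z z′

  -- The prefix of length `1 + P n` ends with 010, whose image is 01001.
  After001-10 : ∀ {n} → Ends false n → After001 (P (1 + P n))
  After001-10 {n} en with Ends-1-P (Ends-0-P en)
  ... | o , e , z = o , (z , trans (cong w (sym e)) (w-P (P n))) ,
    trans (P-suc-0 (w-P n)) (cong (2 +_) e)

  tens : ℕ → ℕ
  tens zero    = 0
  tens (suc j) = P (1 + P (tens j))

  tens-0 : ∀ j → w (tens j) ≡ false
  tens-0 zero    = w-P 0
  tens-0 (suc j) = w-P (1 + P (tens j))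

  tens-Ends01 : ∀ j → Ends01 (tens (suc j))
  tens-Ends01 j = P (P (tens j)) , P-suc-0 (w-P (tens j)) , w-P (P (tens j)) , w-1+P (P (tens j)) (w-P (tens j))

  Ends01⇒Ends : ∀ {n} → Ends01 n → Ends true n
  Ends01⇒Ends (j , e , _ , b) = suc j , e , b

  -- From `j = 2` on, the prefix of length `tens j` ends with 101; the two smaller values are less
  -- than 3.
  tens-¬After001 : ∀ j → ¬ After001 (tens j)
  tens-¬After001 zero (_ , _ , ())
  tens-¬After001 (suc zero) (o , _ , e) with trans (sym (P-suc-0 (w-P 0))) e
  ... | ()
  tens-¬After001 (suc (suc j)) (o , (z , _) , e)
    with Ends-0-P (Ends-1-P (Ends01⇒Ends (tens-Ends01 j)))
  ... | i , e′ , h = 0≢1 z (trans (cong w o≡i) h)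
    where
    o≡i : o ≡ i
    o≡i = suc-injective (trans (sym (suc-injective (suc-injective (trans (sym (P-suc-0 (w-P (tens (suc j))))) e)))) e′)

  tens-≢P : ∀ j {ν} → After001 ν → tens j ≢ P ν
  tens-≢P zero    (_ , _ , refl) e = <-irrefl e (≤-<-trans z≤n (P-< _))
  tens-≢P (suc j) aν e = P≢1+P′ (P-injective e)
    where
    P≢1+P′ : 1 + P (tens j) ≡ _ → ⊥
    P≢1+P′ e′ = 0≢1 (After001-0 aν) (trans (cong w (sym e′)) (w-1+P (tens j) (tens-0 j)))

  tens-Isolated : ∀ j → Isolated (tens j)
  tens-Isolated zero    = Isolated-zero
  tens-Isolated (suc j) = Isolated-10 (tens-0 j) (tens-Isolated j) (tens-¬After001 j) (tens-≢P j)

  foldl-tens : ∀ a j → foldl append (tens j) (rep a (true ∷ false ∷ [])) ≡ tens (a + j)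
  foldl-tens zero    j = refl
  foldl-tens (suc a) j = trans (foldl-tens a (suc j)) (cong tens (+-suc a j))

  Good : ℕ → Set
  Good μ = After001 μ × Isolated μ

  Good-00 : ∀ c {n} → Good n → Good (foldl append n (rep c (false ∷ false ∷ [])))
  Good-00 zero    g         = g
  Good-00 (suc c) {n} (an , iso) = Good-00 c
    (After001-PP (After001⇒Ends01 an) , Isolated-P-0 (w-P n) (Isolated-P-0 (After001-0 an) iso))

  prefix-value : ∀ {u} → InPrefixLang u → Σ ℕ λ μ → Good μ × (foldl append 0 u ≡ P μ)
  prefix-value (suc a , c , b , s≤s z≤n , hb , refl) =
    foldl append (foldl append (P n) b) (rep c (false ∷ false ∷ [])) , Good-00 c (good hb) , value
    where
    n : ℕ
    n = tens (suc a)
    good : ∀ {b} → (b ≡ false ∷ []) ⊎ (b ≡ true ∷ false ∷ []) → Good (foldl append (P n) b)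
    good (inj₁ refl) = After001-PP (tens-Ends01 a) ,
      Isolated-P-0 (w-P n) (Isolated-P-0 (tens-0 (suc a)) (tens-Isolated (suc a)))
    good (inj₂ refl) = After001-10 ends0 ,
      Isolated-10 (w-P n) (Isolated-P-0 (tens-0 (suc a)) (tens-Isolated (suc a)))
        (λ aPn → Ends-unique (After001⇒Ends aPn) ends0)
        (λ aν e → tens-¬After001 (suc a) (subst After001 (sym (P-injective e)) aν))
      where
      ends0 : Ends false (P n)
      ends0 = Ends-1-P (Ends01⇒Ends (tens-Ends01 a))
    10s 00s : List Bool
    10s = rep (suc a) (true ∷ false ∷ [])
    00s = rep c (false ∷ false ∷ [])
    open ≡-Reasoning
    value : foldl append 0 (10s ++ (false ∷ []) ++ b ++ 00s ++ false ∷ []) ≡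
      P (foldl append (foldl append (P n) b) 00s)
    value = begin
      foldl append 0 (10s ++ (false ∷ []) ++ b ++ 00s ++ false ∷ [])
        ≡⟨ foldl-++ append 0 10s _ ⟩
      foldl append (P (foldl append 0 10s)) (b ++ 00s ++ false ∷ [])
        ≡⟨ cong (λ i → foldl append (P i) (b ++ 00s ++ false ∷ [])) (trans (foldl-tens (suc a) 0) (cong tens (+-identityʳ (suc a)))) ⟩
      foldl append (P n) (b ++ 00s ++ false ∷ [])
        ≡⟨ foldl-++ append (P n) b _ ⟩
      foldl append (foldl append (P n) b) (00s ++ false ∷ [])
        ≡⟨ foldl-++ append (foldl append (P n) b) 00s _ ⟩
      P (foldl append (foldl append (P n) b) 00s) ∎

  -- The suffix and the length of the run

  P^-P : ∀ k n → P^ k (P n) ≡ P (P^ k n)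
  P^-P zero    n = refl
  P^-P (suc k) n = cong P (P^-P k n)

  -- The digits (10)*(ε + 1) are the largest possible, so that adding 1 carries
  -- into the digit in front of them.
  suffix-value : ∀ d {e} → (e ≡ []) ⊎ (e ≡ true ∷ []) → ∀ n → w n ≡ false →
    1 + foldl append n (rep d (true ∷ false ∷ []) ++ e) ≡ P^ (length (rep d (true ∷ false ∷ []) ++ e)) (1 + n)
  suffix-value zero (inj₁ refl) n h = refl
  suffix-value zero (inj₂ refl) n h = sym (P-suc-0 h)
  suffix-value (suc d) {e} he n h = begin
    1 + foldl append (P (1 + P n)) ds ≡⟨ suffix-value d he (P (1 + P n)) (w-P (1 + P n)) ⟩
    P^ k (1 + P (1 + P n))            ≡⟨ cong (P^ k) (P-suc-1 (w-1+P n h)) ⟨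
    P^ k (P (2 + P n))                ≡⟨ P^-P k (2 + P n) ⟩
    P (P^ k (2 + P n))                ≡⟨ cong (λ i → P (P^ k i)) (P-suc-0 h) ⟨
    P (P^ k (P (1 + n)))              ≡⟨ cong P (P^-P k (1 + n)) ⟩
    P (P (P^ k (1 + n)))              ∎
    where
    open ≡-Reasoning
    ds : List Bool
    ds = rep d (true ∷ false ∷ []) ++ e
    k : ℕ
    k = length ds

  mutual
    -- The two increments are the lengths of the `r`-th images of 0 and of 1.
    P^-suc-0 : ∀ r n → w n ≡ false → P^ r (1 + n) ≡ P^ r n + F (2 + r)
    P^-suc-0 zero    n h = +-comm 1 n
    P^-suc-0 (suc r) n h = begin
      P (P^ r (1 + n))                    ≡⟨ P^-P r (1 + n) ⟨
      P^ r (P (1 + n))                    ≡⟨ cong (P^ r) (P-suc-0 h) ⟩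
      P^ r (2 + P n)                      ≡⟨ P^-suc-1 r (1 + P n) (w-1+P n h) ⟩
      P^ r (1 + P n) + F (1 + r)          ≡⟨ cong (_+ F (1 + r)) (P^-suc-0 r (P n) (w-P n)) ⟩
      P^ r (P n) + F (2 + r) + F (1 + r)  ≡⟨ +-assoc (P^ r (P n)) _ _ ⟩
      P^ r (P n) + F (3 + r)              ≡⟨ cong (_+ F (3 + r)) (P^-P r n) ⟩
      P (P^ r n) + F (3 + r)              ∎
      where open ≡-Reasoning

    P^-suc-1 : ∀ r n → w n ≡ true → P^ r (1 + n) ≡ P^ r n + F (1 + r)
    P^-suc-1 zero    n h = +-comm 1 n
    P^-suc-1 (suc r) n h = begin
      P (P^ r (1 + n))        ≡⟨ P^-P r (1 + n) ⟨
      P^ r (P (1 + n))        ≡⟨ cong (P^ r) (P-suc-1 h) ⟩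
      P^ r (1 + P n)          ≡⟨ P^-suc-0 r (P n) (w-P n) ⟩
      P^ r (P n) + F (2 + r)  ≡⟨ cong (_+ F (2 + r)) (P^-P r n) ⟩
      P (P^ r n) + F (2 + r)  ∎
      where open ≡-Reasoning

  -- The letters between the two bounds at level 0 are 10, and their `r`-th image has `F (3 + r)`
  -- letters.
  P^-upper-lower : ∀ r μ → P^ r (upper μ) ≡ P^ r (lower μ) + F (3 + r)
  P^-upper-lower r μ = begin
    P^ r (upper μ)                          ≡⟨ P^-suc-0 r (2 + P (P μ)) w-2 ⟩
    P^ r (2 + P (P μ)) + F (2 + r)          ≡⟨ cong (_+ F (2 + r)) (P^-suc-1 r (lower μ) (w-1+P (P μ) (w-P μ))) ⟩
    P^ r (lower μ) + F (1 + r) + F (2 + r)  ≡⟨ +-assoc (P^ r (lower μ)) _ _ ⟩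
    P^ r (lower μ) + (F (1 + r) + F (2 + r)) ≡⟨ cong (P^ r (lower μ) +_) (+-comm (F (1 + r)) (F (2 + r))) ⟩
    P^ r (lower μ) + F (3 + r)              ∎
    where
    open ≡-Reasoning
    w-2 : w (2 + P (P μ)) ≡ false
    w-2 = trans (cong w (sym (P-suc-0 (w-P μ)))) (w-P (1 + P μ))

-- Conclusion for the Fibonacci word

F-positive : ∀ r → 1 ≤ F (1 + r)
F-positive zero    = s≤s z≤n
F-positive (suc r) = ≤-trans (F-positive r) (m≤m+n (F (1 + r)) (F r))

F-lower : ∀ r → 2 + r ≤ F (3 + r)
F-lower zero    = ≤-refl
F-lower (suc r) = ≤-trans (≤-reflexive (+-comm 1 (2 + r))) (+-mono-≤ (F-lower r) (F-positive (1 + r)))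

open FixedPoint fibWord fib-blockStart fib-suc-blockStart

run-of-ones : ∀ {u v} → InPrefixLang u → InWLang v → RunOfOnes (val (u ++ v)) (F (length v + 2) ∸ 1)
run-of-ones {u} pu (d , e , he , refl) with prefix-value pu
... | μ , (aμ , iso) , eu = subst (λ k → RunOfOnes i (F k ∸ 1)) (cong suc (+-comm 2 r))
    ( ≤-pred (≤-trans (m≤m+n 2 r) (≤-trans (F-lower r) (≤-reflexive (sym 1+ℓ))))
    , run-of-cubes aμ iso r i ℓ lo hi )
  where
  ds : List Bool
  ds = rep d (true ∷ false ∷ []) ++ e
  r i ℓ : ℕ
  -- One less than the length of the suffix, whose leading 0 is the outer `P` in `P (P μ)`.
  r = length ds
  i = val (u ++ false ∷ ds)
  ℓ = F (3 + r) ∸ 1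
  1+ℓ : 1 + ℓ ≡ F (3 + r)
  1+ℓ = m+[n∸m]≡n (F-positive (2 + r))
  lo : 1 + i ≡ P^ r (lower μ)
  lo = trans (cong suc (trans (val-foldl (u ++ false ∷ ds)) (trans (foldl-++ append 0 u (false ∷ ds))
    (cong (λ n → foldl append (P n) ds) eu)))) (suffix-value d he (P (P μ)) (fib-blockStart (P μ)))
  hi : 2 + (i + ℓ) ≡ P^ r (upper μ)
  hi = trans (cong suc (sym (+-suc i ℓ))) (trans (cong₂ _+_ lo 1+ℓ) (sym (P^-upper-lower r μ)))

theorem1 : ((L : ℕ) → Σ ℕ λ i → Σ ℕ λ ℓ → (L ≤ ℓ) × RunOfOnes i ℓ) ×
    ((i : ℕ) → (ds : List Bool) → IsZeckRep ds i →
    (u w : List Bool) → InPrefixLang u → InWLang w → ds ≡ u ++ w →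
    ((n : ℕ) → length w ≡ 2 * n → RunOfOnes i (F (2 * n + 2) ∸ 1)) ×
    ((n : ℕ) → length w ≡ 2 * n + 1 → RunOfOnes i (F (2 * n + 3) ∸ 1)))
theorem1 = long-runs , runs
  where
  long-runs : (L : ℕ) → Σ ℕ λ i → Σ ℕ λ ℓ → (L ≤ ℓ) × RunOfOnes i ℓ
  -- The representation used is 10000 followed by 0 and `L` copies of 10.
  long-runs L = _ , _ , L≤ℓ , run-of-ones
    (1 , 0 , false ∷ [] , ≤-refl , inj₁ refl , refl) (L , [] , inj₁ refl , refl)
    where
    length-rep : ∀ d → d ≤ length (rep d (true ∷ false ∷ []) ++ [])
    length-rep zero    = z≤n
    length-rep (suc d) = s≤s (m≤n⇒m≤1+n (length-rep d))
    r : ℕ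
    r = length (rep L (true ∷ false ∷ []) ++ [])
    L≤ℓ : L ≤ F (suc r + 2) ∸ 1
    L≤ℓ = ≤-trans (length-rep L) (≤-trans (n≤1+n r) (∸-monoˡ-≤ 1
      (≤-trans (F-lower r) (≤-reflexive (cong F (cong suc (+-comm 2 r)))))))
  runs : ∀ i ds → IsZeckRep ds i → ∀ u w → InPrefixLang u → InWLang w → ds ≡ u ++ w →
    (∀ n → length w ≡ 2 * n → RunOfOnes i (F (2 * n + 2) ∸ 1)) ×
    (∀ n → length w ≡ 2 * n + 1 → RunOfOnes i (F (2 * n + 3) ∸ 1))
  runs _ _ (_ , _ , refl) u w pu lw refl =
    (λ n e → subst (λ k → RunOfOnes (val (u ++ w)) (F (k + 2) ∸ 1)) e (run-of-ones pu lw)) ,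
    (λ n e → subst (λ k → RunOfOnes (val (u ++ w)) (F k ∸ 1))
      (trans (cong (_+ 2) e) (+-assoc (2 * n) 1 2)) (run-of-ones pu lw))
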